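{- For every even integer $k > 6$ and every integer $y \geq 2$, the graph $K_3 \times K_{ky}$ has a $C_k$-factorization.
   Context: $K_n$ is the complete graph on $n$ vertices. For graphs $G,H$, the tensor product $G \times H$ has vertex set $V(G)\times V(H)$, with $(g_1,h_1)$ adjacent to $(g_2,h_2)$ iff $g_1g_2 \in E(G)$ and $h_1h_2 \in E(H)$. A $C_k$-factor of a graph is a spanning subgraph all of whose components are cycles of length $k$; a $C_k$-factorization is a partition of the edge set into $C_k$-factors. -}

module Defs where

open import Level using (0ℓ)
open import Data.Nat using (ℕ; suc; _*_; _<_; _≤_)
open import Data.Fin using (Fin; toℕ; fromℕ<)
open import Data.Fin.Base using () renaming (zero to fzero; suc to fsuc)
open import Data.Product using (Σ; _×_; _,_; ∃)
open import Data.Sum using (_⊎_)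
open import Data.Nat.Divisibility using (_∣_)
open import Data.Nat.DivMod using (m%n<n)
open import Data.Empty using (⊥)
open import Relation.Binary.PropositionalEquality using (_≡_; _≢_)
open import Relation.Nullary using (¬_)
open import Function.Definitions using (Injective)

record Graph : Set₁ where
  field
    V     : Set
    Adj   : V → V → Set
    sym   : ∀ {u v} → Adj u v → Adj v u
    irrefl : ∀ {v} → ¬ Adj v v
open Graph public

K : ℕ → Graph
K n = record { V = Fin n ; Adj = λ i j → i ≢ j
             ; sym = λ p q → p (Relation.Binary.PropositionalEquality.sym q)
             ; irrefl = λ p → p Relation.Binary.PropositionalEquality.refl }

_⊗_ : Graph → Graph → Graph
G ⊗ H = record { V = V G × V H
               ; Adj = λ { (g₁ , h₁) (g₂ , h₂) → Adj G g₁ g₂ × Adj H h₁ h₂ }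
               ; sym = λ { (a , b) → sym G a , sym H b }
               ; irrefl = λ { (a , b) → irrefl G a } }

next : ∀ {m} → Fin (suc m) → Fin (suc m)
next {m} i = fromℕ< (m%n<n (suc (toℕ i)) (suc m))

-- A k-cycle in G (k = suc m, intended k ≥ 3): an injective vertex map c : Fin k → V G
-- with c i adjacent to c (i+1 mod k). Its edges are {c i , c (next i)}.
record Cycle (G : Graph) (m : ℕ) : Set where
  field
    vert : Fin (suc m) → V G
    inj  : Injective _≡_ _≡_ vert
    adj  : ∀ i → Adj G (vert i) (vert (next i))
open Cycle public

EdgeAt : ∀ {G m} → Cycle G m → Fin (suc m) → V G → V G → Set
EdgeAt C i u v = (vert C i ≡ u × vert C (next i) ≡ v) ⊎ (vert C i ≡ v × vert C (next i) ≡ u)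

record Factor (G : Graph) (m : ℕ) : Set where
  field
    size   : ℕ
    cycles : Fin size → Cycle G m
    cover  : ∀ v → Σ (Fin size) λ j → Σ (Fin (suc m)) λ i → vert (cycles j) i ≡ v
    unique : ∀ v j j′ i i′ → vert (cycles j) i ≡ v → vert (cycles j′) i′ ≡ v → j ≡ j′ × i ≡ i′
open Factor public

record Factorization (G : Graph) (m : ℕ) : Set where
  field
    count   : ℕ
    factors : Fin count → Factor G m
    covers  : ∀ u v → Adj G u v →
              Σ (Fin count) λ f → Σ (Fin (size (factors f))) λ j → Σ (Fin (suc m)) λ i →
                EdgeAt (cycles (factors f) j) i u v
    unique  : ∀ u v f f′ j j′ i i′ →
              EdgeAt (cycles (factors f) j) i u v → EdgeAt (cycles (factors f′) j′) i′ u v →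
              Σ (f ≡ f′) λ { Relation.Binary.PropositionalEquality.refl → j ≡ j′ × i ≡ i′ }

HasCkFactorization : Graph → ℕ → Set
HasCkFactorization G 0 = ⊥
HasCkFactorization G (suc m) = Factorization G m

{-# OPTIONS --safe #-}
-- Let k = 2h. All factors are invariant under translating the K₃-coordinate, read as ℤ₃, so they are
-- described on K_{ky} alone: a factor is a C_k-factor of K_{ky} with a potential to ℤ₃ that is a proper
-- 3-colouring of it. Every edge of K_{ky} has to lie in exactly two factors, with opposite potential
-- differences ±1; it does so once at an even and once at an odd position of the cycles.
-- Cut K_{ky} into 2y groups of size h and take a 1-factorization of K_{2y}. Each 1-factor pairs up
-- the groups; for one of them take the complete graph K_k on every pair, and for the others K_{h,h}.
-- In both K_k and K_{h,h} cyclically ordered 1-factors exist in which any two neighbours form a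
-- Hamiltonian cycle (x + y = c on ℤ/(k − 1) ∪ {∞}, respectively y = x + c on ℤ/h). These cycles are the
-- factors, so that each edge is used twice, and it only remains to choose the potentials.
module Submission where

open import Defs
open import Data.Empty using (⊥; ⊥-elim)
open import Data.Fin using (Fin; zero; suc; toℕ; fromℕ; inject₁; _↑ˡ_; _↑ʳ_; splitAt; join; opposite; combine; remQuot; _≟_)
open import Data.Fin.Patterns using (0F; 1F; 2F; 3F; 4F)
open import Data.Fin.Properties using (toℕ-fromℕ<; toℕ-injective; toℕ<n; toℕ-fromℕ; toℕ-inject₁; toℕ-↑ˡ; toℕ-↑ʳ; toℕ-combine; remQuot-combine; combine-remQuot; splitAt-↑ˡ; splitAt-↑ʳ; join-splitAt; opposite-prop; opposite-involutive; all?; +↔⊎; *↔×)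
open import Data.Fin.Relation.Unary.Top using (View; view; ‵fromℕ; ‵inject₁; view-fromℕ; view-inject₁)
open import Data.List using (List; []; _∷_)
open import Data.List.Membership.Propositional using (_∈_)
open import Data.List.Relation.Unary.All as All using (All)
open import Data.List.Relation.Unary.Any using (here; there)
open import Data.Maybe using (Maybe; just; nothing)
open import Data.Maybe.Properties using (≡-dec)
open import Data.Nat using (ℕ; zero; suc; _+_; _*_; _∸_; _<_; _≤_; s≤s)
open import Data.Nat.Divisibility using (_∣_; divides)
open import Data.Nat.DivMod using (_%_; _mod_; m<n⇒m%n≡m; m%n*o≡m*o%[n*o]; m%n<n; %-distribˡ-+; %-distribˡ-*; m%n%n≡m%n; [m+kn]%n≡m%n; n%n≡0)
open import Data.Nat.Properties using (*-comm; +-comm; +-assoc; +-identityʳ; m∸n+n≡m; <⇒≤)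
open import Data.Nat.Tactic.RingSolver using (solve-∀)
open import Data.Product using (Σ; _×_; _,_; proj₁; proj₂; uncurry; map₂)
open import Data.Product.Function.NonDependent.Propositional using (_×-↔_)
open import Data.Sum as Sum using (_⊎_; inj₁; inj₂)
open import Data.Sum.Function.Propositional using (_⊎-↔_)
open import Data.Unit using (⊤; tt)
open import Data.Vec using (Vec; []; _∷_; lookup)
open import Function.Bundles using (_↔_; Inverse; mk↔ₛ′)
open import Function.Properties.Inverse using (↔-refl; ↔-trans)
open import Relation.Binary.PropositionalEquality using (_≡_; _≢_; refl; trans; cong; cong₂; subst; subst₂; ≢-sym; module ≡-Reasoning) renaming (sym to ≡-sym)
open import Relation.Nullary using (yes; no)
open import Relation.Nullary.Decidable using (from-yes; _→-dec_; ¬?)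

-- Positions on cycles of even length.

-- The position 2j + ε on a cycle of length 2N, split into j and its parity ε.
Position : ℕ → Set
Position N = Fin N × Fin 2

succ : ∀ {n} → Position (suc n) → Position (suc n)
succ (j , 0F) = j , 1F
succ (j , 1F) = next j , 0F

toℕ-next : ∀ {n} (i : Fin (suc n)) → toℕ (next i) ≡ suc (toℕ i) % suc n
toℕ-next {n} i = toℕ-fromℕ< (m%n<n (suc (toℕ i)) (suc n))

next-combine : ∀ {n} (q : Position (suc n)) → next (uncurry combine q) ≡ uncurry combine (succ q)
next-combine {n} (j , 0F) = toℕ-injective (begin
    toℕ (next (combine j 0F))                     ≡⟨ toℕ-next (combine j 0F) ⟩
    suc (toℕ (combine j 0F)) % (suc n * 2)        ≡⟨ cong (λ t → suc t % (suc n * 2)) (toℕ-combine j 0F) ⟩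
    suc (2 * toℕ j + 0) % (suc n * 2)             ≡⟨ cong (_% (suc n * 2)) suc-even ⟩
    toℕ (combine j 1F) % (suc n * 2)              ≡⟨ m<n⇒m%n≡m (toℕ<n (combine j 1F)) ⟩
    toℕ (combine j 1F)                            ∎)
  where
  open ≡-Reasoning
  suc-even : suc (2 * toℕ j + 0) ≡ toℕ (combine j 1F)
  suc-even = begin
    suc (2 * toℕ j + 0)  ≡⟨ cong suc (+-identityʳ (2 * toℕ j)) ⟩
    suc (2 * toℕ j)      ≡⟨ +-comm 1 (2 * toℕ j) ⟩
    2 * toℕ j + 1        ≡⟨ toℕ-combine j 1F ⟨
    toℕ (combine j 1F)   ∎
next-combine {n} (j , 1F) = toℕ-injective (begin
    toℕ (next (combine j 1F))                     ≡⟨ toℕ-next (combine j 1F) ⟩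
    suc (toℕ (combine j 1F)) % (suc n * 2)        ≡⟨ cong (λ t → suc t % (suc n * 2)) (toℕ-combine j 1F) ⟩
    suc (2 * toℕ j + 1) % (suc n * 2)             ≡⟨ cong (_% (suc n * 2)) suc-odd ⟩
    -- Reducing an even number modulo 2(n + 1) amounts to reducing its half modulo n + 1, so the
    -- wrap-around at the end of the cycle needs no separate case.
    (suc (toℕ j) * 2) % (suc n * 2)               ≡⟨ m%n*o≡m*o%[n*o] (suc (toℕ j)) (suc n) 2 ⟨
    (suc (toℕ j) % suc n) * 2                     ≡⟨ cong (_* 2) (toℕ-next j) ⟨
    toℕ (next j) * 2                              ≡⟨ *-comm (toℕ (next j)) 2 ⟩
    2 * toℕ (next j)                              ≡⟨ +-identityʳ (2 * toℕ (next j)) ⟨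
    2 * toℕ (next j) + 0                          ≡⟨ toℕ-combine {n = 2} (next j) 0F ⟨
    toℕ (combine {suc n} {2} (next j) 0F)             ∎)
  where
  open ≡-Reasoning
  suc-odd : suc (2 * toℕ j + 1) ≡ suc (toℕ j) * 2
  suc-odd = cong suc (trans (+-comm (2 * toℕ j) 1) (cong suc (*-comm 2 (toℕ j))))

remQuot-next : ∀ {n} (i : Fin (suc n * 2)) → remQuot {suc n} 2 (next i) ≡ succ (remQuot {suc n} 2 i)
remQuot-next {n} i = begin
  remQuot {suc n} 2 (next i)                                    ≡⟨ cong (λ t → remQuot {suc n} 2 (next t)) (combine-remQuot {suc n} 2 i) ⟨
  remQuot {suc n} 2 (next (uncurry combine (remQuot {suc n} 2 i))) ≡⟨ cong (remQuot {suc n} 2) (next-combine (remQuot {suc n} 2 i)) ⟩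
  remQuot {suc n} 2 (uncurry combine (succ (remQuot {suc n} 2 i))) ≡⟨ remQuot-combine {suc n} {2} _ _ ⟩
  succ (remQuot {suc n} 2 i)                                     ∎
  where open ≡-Reasoning

-- Arithmetic in ℤ₃.

infixl 6 _⊕_ _⊖_

_⊕_ _⊖_ : Fin 3 → Fin 3 → Fin 3
a ⊕ b = (toℕ a + toℕ b) mod 3
a ⊖ b = (toℕ a + (3 ∸ toℕ b)) mod 3

⊕-⊖ : ∀ a b → a ⊕ (b ⊖ a) ≡ b
⊕-⊖ = from-yes (all? λ a → all? λ b → a ⊕ (b ⊖ a) ≟ b)

⊕-cancelʳ : ∀ g a b → a ⊕ g ≡ b ⊕ g → a ≡ b
⊕-cancelʳ = from-yes (all? λ g → all? λ a → all? λ b → (a ⊕ g ≟ b ⊕ g) →-dec (a ≟ b))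

⊕-cancelˡ : ∀ a g h → a ⊕ g ≡ a ⊕ h → g ≡ h
⊕-cancelˡ = from-yes (all? λ a → all? λ g → all? λ h → (a ⊕ g ≟ a ⊕ h) →-dec (g ≟ h))

⊕-⊖-⊕ : ∀ a b g → (a ⊕ g) ⊖ (b ⊕ g) ≡ a ⊖ b
⊕-⊖-⊕ = from-yes (all? λ a → all? λ b → all? λ g → (a ⊕ g) ⊖ (b ⊕ g) ≟ a ⊖ b)

⊖≡0 : ∀ a b → a ⊖ b ≡ 0F → a ≡ b
⊖≡0 = from-yes (all? λ a → all? λ b → (a ⊖ b ≟ 0F) →-dec (a ≟ b))

-- Read b and d as the potentials at the ends of a base edge, a and c as the wanted ℤ₃-coordinates.
-- The shift a - b that settles the first end then settles the second one too.
⊖-determines : ∀ a b c d → c ⊖ a ≡ d ⊖ b → d ⊕ (a ⊖ b) ≡ c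
⊖-determines = from-yes (all? λ a → all? λ b → all? λ c → all? λ d → (c ⊖ a ≟ d ⊖ b) →-dec (d ⊕ (a ⊖ b) ≟ c))

-- This is why two base factors through each base edge are enough to reach all its lifts.
two-nonzero : ∀ (d e : Fin 3) {x} → x ≢ 0F → d ≢ 0F → e ≢ 0F → d ≢ e → x ≡ d ⊎ x ≡ e
two-nonzero 0F e  x≢ d≢ e≢ d≢e = ⊥-elim (d≢ refl)
two-nonzero 1F 0F x≢ d≢ e≢ d≢e = ⊥-elim (e≢ refl)
two-nonzero 2F 0F x≢ d≢ e≢ d≢e = ⊥-elim (e≢ refl)
two-nonzero 1F 1F x≢ d≢ e≢ d≢e = ⊥-elim (d≢e refl)
two-nonzero 2F 2F x≢ d≢ e≢ d≢e = ⊥-elim (d≢e refl)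
two-nonzero 1F 2F {0F} x≢ d≢ e≢ d≢e = ⊥-elim (x≢ refl)
two-nonzero 1F 2F {1F} x≢ d≢ e≢ d≢e = inj₁ refl
two-nonzero 1F 2F {2F} x≢ d≢ e≢ d≢e = inj₂ refl
two-nonzero 2F 1F {0F} x≢ d≢ e≢ d≢e = ⊥-elim (x≢ refl)
two-nonzero 2F 1F {1F} x≢ d≢ e≢ d≢e = inj₂ refl
two-nonzero 2F 1F {2F} x≢ d≢ e≢ d≢e = inj₁ refl

-- Schemes on the base graph and their lift to the tensor product.

-- A ℤ₃-invariant factorization of K₃ × (B , E), described on the base graph (B , E).
-- Factor f has base cycles p ↦ at f p and a potential col f; it lifts to the cycles
-- whose position q is (col f (at f p q) + g , at f p q), for g ∈ ℤ₃.
record Scheme {B : Set} (E : B → B → Set) (I P : Set) (n : ℕ) : Set where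
  field
    at     : I → P → Position (suc n) → B
    loc    : I → B → P × Position (suc n)
    at-loc : ∀ f b → uncurry (at f) (loc f b) ≡ b
    loc-at : ∀ f p q → loc f (at f p q) ≡ (p , q)
    col    : I → B → Fin 3

  Joins : I → P → Position (suc n) → B → B → Set
  Joins f p q b b′ = (at f p q ≡ b × at f p (succ q) ≡ b′) ⊎ (at f p q ≡ b′ × at f p (succ q) ≡ b)

  field
    edge : ∀ f p q → E (at f p q) (at f p (succ q))
    joins-covers : ∀ ε {b b′} → E b b′ → Σ I λ f → Σ P λ p → Σ (Fin (suc n)) λ j → Joins f p (j , ε) b b′
    -- Equality of the factors suffices: within one factor, `joins-position` recovers the cycle and
    -- the position.
    joins-unique : ∀ ε {b b′ f f′ p p′ j j′} → Joins f p (j , ε) b b′ → Joins f′ p′ (j′ , ε) b b′ → f ≡ f′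
    proper : ∀ f p q → col f (at f p q) ≢ col f (at f p (succ q))
    opposed : ∀ {b b′ f f′ p p′ j j′} → Joins f p (j , 0F) b b′ → Joins f′ p′ (j′ , 1F) b b′ →
               col f b′ ⊖ col f b ≢ col f′ b′ ⊖ col f′ b

  at-injective : ∀ f {p p′ q q′} → at f p q ≡ at f p′ q′ → (p , q) ≡ (p′ , q′)
  at-injective f {p} {p′} {q} {q′} e = trans (≡-sym (loc-at f p q)) (trans (cong (loc f) e) (loc-at f p′ q′))

  proper-joins : ∀ {f p q b b′} → Joins f p q b b′ → col f b ≢ col f b′
  proper-joins {f} {p} {q} (inj₁ (refl , refl)) = proper f p q
  proper-joins {f} {p} {q} (inj₂ (refl , refl)) e = proper f p q (≡-sym e)

  -- Two positions of the same parity are never consecutive.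
  joins-position : ∀ {f ε p p′ j j′ b b′} → Joins f p (j , ε) b b′ → Joins f p′ (j′ , ε) b b′ → (p , j) ≡ (p′ , j′)
  joins-position {f} (inj₁ (x , _)) (inj₁ (y , _)) = cong (λ (p , (j , _)) → p , j) (at-injective f (trans x (≡-sym y)))
  joins-position {f} (inj₂ (x , _)) (inj₂ (y , _)) = cong (λ (p , (j , _)) → p , j) (at-injective f (trans x (≡-sym y)))
  joins-position {f} {0F} (inj₁ (x , _)) (inj₂ (_ , y)) with () ← at-injective f (trans x (≡-sym y))
  joins-position {f} {1F} (inj₁ (x , _)) (inj₂ (_ , y)) with () ← at-injective f (trans x (≡-sym y))
  joins-position {f} {0F} (inj₂ (x , _)) (inj₁ (_ , y)) with () ← at-injective f (trans x (≡-sym y))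
  joins-position {f} {1F} (inj₂ (x , _)) (inj₁ (_ , y)) with () ← at-injective f (trans x (≡-sym y))

module Lift {N n c s : ℕ} {I P : Set} (S : Scheme {Fin N} _≢_ I P n) (I↔ : Fin c ↔ I) (P↔ : Fin s ↔ P) where
  open Scheme S
  module I↔ = Inverse I↔
  module P↔ = Inverse P↔

  G : Graph
  G = K 3 ⊗ K N

  point : I → P → Fin 3 → Position (suc n) → V G
  point f p g q = col f (at f p q) ⊕ g , at f p q

  point-injective : ∀ f {p p′ g g′ q q′} → point f p g q ≡ point f p′ g′ q′ → p ≡ p′ × g ≡ g′ × q ≡ q′
  point-injective f {p} {g = g} {g′} {q} e with at-injective f (cong proj₂ e)
  ... | refl = refl , ⊕-cancelˡ (col f (at f p q)) g g′ (cong proj₁ e) , refl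

  base : Fin (s * 3) → P
  base t = P↔.to (proj₁ (remQuot {s} 3 t))

  shift : Fin (s * 3) → Fin 3
  shift t = proj₂ (remQuot {s} 3 t)

  slot : P → Fin 3 → Fin (s * 3)
  slot p g = combine (P↔.from p) g

  base-slot : ∀ p g → base (slot p g) ≡ p
  base-slot p g = trans (cong (λ r → P↔.to (proj₁ r)) (remQuot-combine {s} {3} (P↔.from p) g)) (P↔.strictlyInverseˡ p)

  shift-slot : ∀ p g → shift (slot p g) ≡ g
  shift-slot p g = cong proj₂ (remQuot-combine {s} {3} (P↔.from p) g)

  slot-base : ∀ t → slot (base t) (shift t) ≡ t
  slot-base t = trans (cong (λ r → combine r (shift t)) (P↔.strictlyInverseʳ _)) (combine-remQuot {s} 3 t)

  ⟦_⟧ : Fin (suc n * 2) → Position (suc n)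
  ⟦ i ⟧ = remQuot {suc n} 2 i

  ⌜_⌝ : Position (suc n) → Fin (suc n * 2)
  ⌜ q ⌝ = uncurry combine q

  ⟦⌜_⌝⟧ : ∀ q → ⟦ ⌜ q ⌝ ⟧ ≡ q
  ⟦⌜ j , ε ⌝⟧ = remQuot-combine j ε

  ⟦⟧-injective : ∀ i i′ → ⟦ i ⟧ ≡ ⟦ i′ ⟧ → i ≡ i′
  ⟦⟧-injective i i′ e = trans (≡-sym (combine-remQuot {suc n} 2 i)) (trans (cong ⌜_⌝ e) (combine-remQuot {suc n} 2 i′))

  slot-injective : ∀ {t t′} → base t ≡ base t′ → shift t ≡ shift t′ → t ≡ t′
  slot-injective {t} {t′} e e′ = trans (≡-sym (slot-base t)) (trans (cong₂ slot e e′) (slot-base t′))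

  cycle : I → Fin (s * 3) → Cycle G (suc (n * 2))
  cycle f t = record
    { vert = λ i → point f (base t) (shift t) ⟦ i ⟧
    ; inj  = λ {i} {i′} e → ⟦⟧-injective i i′ (proj₂ (proj₂ (point-injective f e)))
    ; adj  = λ i → subst (λ q → Adj G (point f (base t) (shift t) ⟦ i ⟧) (point f (base t) (shift t) q))
                         (≡-sym (remQuot-next i))
                         ( (λ e → proper f (base t) ⟦ i ⟧ (⊕-cancelʳ (shift t) _ _ e))
                         , edge f (base t) ⟦ i ⟧)
    }

  vert-point : ∀ f t i {p g q} → base t ≡ p → shift t ≡ g → ⟦ i ⟧ ≡ q → vert (cycle f t) i ≡ point f p g q
  vert-point f t i refl refl refl = refl

  vert-slot : ∀ f p g q → vert (cycle f (slot p g)) ⌜ q ⌝ ≡ point f p g q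
  vert-slot f p g q = vert-point f (slot p g) ⌜ q ⌝ (base-slot p g) (shift-slot p g) ⟦⌜ q ⌝⟧

  vert-slot-next : ∀ f p g q → vert (cycle f (slot p g)) (next ⌜ q ⌝) ≡ point f p g (succ q)
  vert-slot-next f p g q = vert-point f (slot p g) (next ⌜ q ⌝) (base-slot p g) (shift-slot p g) (trans (remQuot-next ⌜ q ⌝) (cong succ ⟦⌜ q ⌝⟧))

  factor : I → Factor G (suc (n * 2))
  factor f = record
    { size   = s * 3
    ; cycles = cycle f
    -- Among the three shifts of the base cycle through b, the shift a - col f b is the one that
    -- meets (a , b).
    ; cover  = λ (a , b) → let (p , q) = loc f b ; g = a ⊖ col f b in
        slot p g , ⌜ q ⌝ , trans (vert-slot f p g q)
          (cong₂ _,_ (trans (cong (λ x → col f x ⊕ g) (at-loc f b)) (⊕-⊖ (col f b) a)) (at-loc f b))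
    ; unique = λ v j j′ i i′ e e′ → let (x , y , z) = point-injective f (trans e (≡-sym e′)) in
        slot-injective x y , ⟦⟧-injective i i′ z
    }

  -- The potential depends on the base vertex alone, so the ℤ₃-coordinates are attached to the
  -- endpoints independently of the direction in which the cycle runs through the base edge.
  Over : I → P → Fin 3 → Position (suc n) → V G → V G → Set
  Over f p g q (a , b) (a′ , b′) = Joins f p q b b′ × col f b ⊕ g ≡ a × col f b′ ⊕ g ≡ a′

  over-points : ∀ {f p g q u v} →
                (point f p g q ≡ u × point f p g (succ q) ≡ v) ⊎ (point f p g q ≡ v × point f p g (succ q) ≡ u) →
                Over f p g q u v
  over-points (inj₁ (refl , refl)) = inj₁ (refl , refl) , refl , refl
  over-points (inj₂ (refl , refl)) = inj₂ (refl , refl) , refl , refl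

  over : ∀ {f t i u v} → EdgeAt (cycle f t) i u v → Over f (base t) (shift t) ⟦ i ⟧ u v
  over {f} {t} {i} e = over-points (Sum.map (map₂ (trans unfold)) (map₂ (trans unfold)) e)
    where unfold = ≡-sym (vert-point f t (next i) refl refl (remQuot-next i))

  edgeAt : ∀ {f p g q u v} → Over f p g q u v → EdgeAt (cycle f (slot p g)) ⌜ q ⌝ u v
  edgeAt {f} {p} {g} {q} (inj₁ (refl , refl) , refl , refl) = inj₁ (vert-slot f p g q , vert-slot-next f p g q)
  edgeAt {f} {p} {g} {q} (inj₂ (refl , refl) , refl , refl) = inj₂ (vert-slot f p g q , vert-slot-next f p g q)

  lift-joins : ∀ {f p q a a′ b b′} → Joins f p q b b′ → a′ ⊖ a ≡ col f b′ ⊖ col f b →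
               Σ I λ f → Σ P λ p → Σ (Fin 3) λ g → Σ (Position (suc n)) λ q → Over f p g q (a , b) (a′ , b′)
  lift-joins {f} {p} {q} {a} {a′} {b} {b′} J e = f , p , a ⊖ col f b , q , J , ⊕-⊖ (col f b) a , ⊖-determines a (col f b) a′ (col f b′) e

  -- The difference a′ - a is nonzero. The even and the odd base cycle through {b , b′} have
  -- nonzero, distinct differences by properness and `opposed`, so one of them has the required one.
  covers-over : ∀ u v → Adj G u v →
                Σ I λ f → Σ P λ p → Σ (Fin 3) λ g → Σ (Position (suc n)) λ q → Over f p g q u v
  covers-over (a , b) (a′ , b′) (a≢a′ , b≢b′) =
    let (f , p , j , J)     = joins-covers 0F b≢b′
        (f′ , p′ , j′ , J′) = joins-covers 1F b≢b′
    in Sum.[ lift-joins J , lift-joins J′ ]′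
         (two-nonzero (col f b′ ⊖ col f b) (col f′ b′ ⊖ col f′ b)
           (λ e → a≢a′ (≡-sym (⊖≡0 a′ a e)))
           (λ e → proper-joins J (≡-sym (⊖≡0 _ _ e)))
           (λ e → proper-joins J′ (≡-sym (⊖≡0 _ _ e)))
           (opposed J J′))

  over-difference : ∀ {f p g q a a′ b b′} → Over f p g q (a , b) (a′ , b′) → a′ ⊖ a ≡ col f b′ ⊖ col f b
  over-difference {f} {g = g} {b = b} {b′} (_ , refl , refl) = ⊕-⊖-⊕ (col f b′) (col f b) g

  over-same-parity : ∀ ε {f f′ p p′ g g′ j j′ u v} → Over f p g (j , ε) u v → Over f′ p′ g′ (j′ , ε) u v →
                     f ≡ f′ × p ≡ p′ × g ≡ g′ × (j , ε) ≡ (j′ , ε)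
  over-same-parity ε {f} {g = g} {g′} {u = a , b} (J , e , _) (J′ , e′ , _) with joins-unique ε J J′
  ... | refl with joins-position J J′
  ... | refl = refl , refl , ⊕-cancelˡ (col f b) g g′ (trans e (≡-sym e′)) , refl

  -- An edge over both an even and an odd position would have equal potential differences in the two
  -- factors, against `opposed`.
  over-unique : ∀ {f f′ p p′ g g′ q q′ u v} → Over f p g q u v → Over f′ p′ g′ q′ u v →
                f ≡ f′ × p ≡ p′ × g ≡ g′ × q ≡ q′
  over-unique {q = _ , 0F} {_ , 0F} O O′ = over-same-parity 0F O O′
  over-unique {q = _ , 1F} {_ , 1F} O O′ = over-same-parity 1F O O′
  over-unique {q = _ , 0F} {_ , 1F} O O′ =
    ⊥-elim (opposed (proj₁ O) (proj₁ O′) (trans (≡-sym (over-difference O)) (over-difference O′)))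
  over-unique {q = _ , 1F} {_ , 0F} O O′ =
    ⊥-elim (opposed (proj₁ O′) (proj₁ O) (trans (≡-sym (over-difference O′)) (over-difference O)))

  open Factorization

  factorization : Factorization G (suc (n * 2))
  factorization .count = c
  factorization .factors x = factor (I↔.to x)
  factorization .covers u v A =
    let (f , p , g , q , O) = covers-over u v A in
    I↔.from f , slot p g , ⌜ q ⌝
    , subst (λ f → EdgeAt (cycle f (slot p g)) ⌜ q ⌝ u v) (≡-sym (I↔.strictlyInverseˡ f)) (edgeAt O)
  factorization .unique u v x x′ j j′ i i′ e e′ with over-unique (over {i = i} e) (over {i = i′} e′)
  ... | f≡f′ , p≡p′ , g≡g′ , q≡q′
    with trans (≡-sym (I↔.strictlyInverseʳ x)) (trans (cong I↔.from f≡f′) (I↔.strictlyInverseʳ x′))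
  ... | refl = refl , slot-injective p≡p′ g≡g′ , ⟦⟧-injective i i′ q≡q′

-- Cyclic successors and residues.

next-inject₁ : ∀ {n} (i : Fin n) → next (inject₁ i) ≡ suc i
next-inject₁ {n} i = toℕ-injective (begin
  toℕ (next (inject₁ i))          ≡⟨ toℕ-next (inject₁ i) ⟩
  suc (toℕ (inject₁ i)) % suc n   ≡⟨ cong (λ t → suc t % suc n) (toℕ-inject₁ i) ⟩
  suc (toℕ i) % suc n             ≡⟨ m<n⇒m%n≡m (s≤s (toℕ<n i)) ⟩
  suc (toℕ i)                     ∎)
  where open ≡-Reasoning

next-fromℕ : ∀ n → next (fromℕ n) ≡ zero
next-fromℕ n = toℕ-injective (begin
  toℕ (next (fromℕ n))          ≡⟨ toℕ-next (fromℕ n) ⟩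
  suc (toℕ (fromℕ n)) % suc n   ≡⟨ cong (λ t → suc t % suc n) (toℕ-fromℕ n) ⟩
  suc n % suc n                 ≡⟨ n%n≡0 (suc n) ⟩
  0                             ∎)
  where open ≡-Reasoning

module Residue (μ : ℕ) where
  m : ℕ
  m = suc μ

  residue : ℕ → Fin m
  residue a = a mod m

  toℕ-residue : ∀ a → toℕ (residue a) ≡ a % m
  toℕ-residue a = toℕ-fromℕ< (m%n<n a m)

  -- A record rather than an abbreviation, so that the two sides can be inferred.
  infix 4 _≋_
  record _≋_ (a b : ℕ) : Set where
    constructor congruent
    field equal-% : a % m ≡ b % m

  ≋-refl : ∀ {a} → a ≋ a
  ≋-refl = congruent refl

  residue-cong : ∀ {a b} → a ≋ b → residue a ≡ residue b
  residue-cong {a} {b} (congruent e) = toℕ-injective (trans (toℕ-residue a) (trans e (≡-sym (toℕ-residue b))))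

  residue-+* : ∀ a b c → a ≡ b + c * m → residue a ≡ residue b
  residue-+* a b c e = residue-cong {a} {b} (congruent (trans (cong (_% m) e) ([m+kn]%n≡m%n b c m)))

  residue-toℕ : ∀ x → residue (toℕ x) ≡ x
  residue-toℕ x = toℕ-injective (trans (toℕ-residue (toℕ x)) (m<n⇒m%n≡m (toℕ<n x)))

  toℕ-residue-≋ : ∀ a → toℕ (residue a) ≋ a
  toℕ-residue-≋ a = congruent (trans (cong (_% m) (toℕ-residue a)) (m%n%n≡m%n a m))

  +-≋ : ∀ {a a′ b b′} → a ≋ a′ → b ≋ b′ → a + b ≋ a′ + b′
  +-≋ {a} {a′} {b} {b′} (congruent e) (congruent e′) = congruent
    (trans (%-distribˡ-+ a b m) (trans (cong₂ (λ x y → (x + y) % m) e e′) (≡-sym (%-distribˡ-+ a′ b′ m))))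

  *-≋ : ∀ k {a a′} → a ≋ a′ → k * a ≋ k * a′
  *-≋ k {a} {a′} (congruent e) = congruent
    (trans (%-distribˡ-* k a m) (trans (cong (λ x → ((k % m) * x) % m) e) (≡-sym (%-distribˡ-* k a′ m))))

  infixl 6 _⊞_ _⊟_

  -- Offsets are natural numbers, so that they accumulate in ℕ, where the ring solver applies;
  -- negative offsets are represented by adding m.
  _⊞_ : Fin m → ℕ → Fin m
  x ⊞ a = residue (toℕ x + a)

  _⊟_ : Fin m → Fin m → Fin m
  x ⊟ y = x ⊞ (m ∸ toℕ y)

  ⊞-⊞ : ∀ x a b → x ⊞ a ⊞ b ≡ x ⊞ (a + b)
  ⊞-⊞ x a b = trans (residue-cong (+-≋ {b = b} (toℕ-residue-≋ (toℕ x + a)) ≋-refl))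
                    (cong residue (+-assoc (toℕ x) a b))

  ⊞-period : ∀ x a → x ⊞ (a + m) ≡ x ⊞ a
  ⊞-period x a = residue-+* _ (toℕ x + a) 1
    (trans (≡-sym (+-assoc (toℕ x) a m)) (cong (toℕ x + a +_) (≡-sym (+-identityʳ m))))

  ⊞-zero : ∀ x → x ⊞ 0 ≡ x
  ⊞-zero x = trans (cong residue (+-identityʳ (toℕ x))) (residue-toℕ x)

  ⊞-⊞-period : ∀ x a b → a + b ≡ m → x ⊞ a ⊞ b ≡ x
  ⊞-⊞-period x a b e = trans (⊞-⊞ x a b) (trans (cong (x ⊞_) e) (trans (⊞-period x 0) (⊞-zero x)))

  m∸toℕ : ∀ (x : Fin m) → m ∸ toℕ x + toℕ x ≡ m
  m∸toℕ x = m∸n+n≡m (<⇒≤ (toℕ<n x))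

  ⊟-⊞ : ∀ x y → x ⊟ y ⊞ toℕ y ≡ x
  ⊟-⊞ x y = ⊞-⊞-period x (m ∸ toℕ y) (toℕ y) (m∸toℕ y)

  ⊞-comm : ∀ x y → x ⊞ toℕ y ≡ y ⊞ toℕ x
  ⊞-comm x y = cong residue (+-comm (toℕ x) (toℕ y))

  ⊞-⊟ : ∀ x a → x ⊞ a ⊟ x ≡ residue a
  ⊞-⊟ x a = trans (⊞-⊞ x a (m ∸ toℕ x)) (residue-+* _ a 1 (begin
    toℕ x + (a + (m ∸ toℕ x))   ≡⟨ rearrange (toℕ x) a (m ∸ toℕ x) ⟩
    a + (m ∸ toℕ x + toℕ x)     ≡⟨ cong (a +_) (m∸toℕ x) ⟩
    a + m                       ≡⟨ cong (a +_) (+-identityʳ m) ⟨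
    a + 1 * m                   ∎))
    where
    open ≡-Reasoning
    rearrange : ∀ x a b → x + (a + b) ≡ a + (b + x)
    rearrange = solve-∀

-- Walecki's Hamiltonian cycles.

-- Walecki's rotational Hamiltonian cycles of the complete graph on ℤ/(2n+1) ∪ {∞} (∞ is nothing).
-- Cycle s zigzags s, s − 1, s + 1, s − 2, …, s + n, ∞; the sums of the endpoints of its
-- edges at even positions are all 2s − 1, and at odd positions 2s.
module Walecki (n : ℕ) where
  open Residue (n + n) public

  Vertex : Set
  Vertex = Maybe (Fin m)

  -- The offset n + 1 + (n - 1 - i) is -(i + 1) modulo 2n + 1. In this form the even positions take
  -- the offsets 0, ..., n and the odd ones the rest, which `place` inverts by `splitAt`.
  odd : Fin m → {j : Fin (suc n)} → View j → Vertex
  odd s ‵fromℕ       = nothing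
  odd s (‵inject₁ i) = just (s ⊞ (suc n + toℕ (opposite i)))

  at : Fin m → Position (suc n) → Vertex
  at s (j , 0F) = just (s ⊞ toℕ j)
  at s (j , 1F) = odd s (view j)

  at-last : ∀ s → at s (fromℕ n , 1F) ≡ nothing
  at-last s rewrite view-fromℕ n = refl

  at-odd : ∀ s i → at s (inject₁ i , 1F) ≡ just (s ⊞ (suc n + toℕ (opposite i)))
  at-odd s i rewrite view-inject₁ i = refl

  place : Fin m → Position (suc n)
  place a = Sum.[ (λ j → j , 0F) , (λ i → inject₁ (opposite i) , 1F) ]′ (splitAt (suc n) a)

  loc : Fin m → Vertex → Position (suc n)
  loc s nothing  = fromℕ n , 1F
  loc s (just x) = place (x ⊟ s)

  place-↑ˡ : ∀ j → place (j ↑ˡ n) ≡ (j , 0F)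
  place-↑ˡ j rewrite splitAt-↑ˡ (suc n) j n = refl

  place-↑ʳ : ∀ i → place (suc n ↑ʳ i) ≡ (inject₁ (opposite i) , 1F)
  place-↑ʳ i rewrite splitAt-↑ʳ (suc n) n i = refl

  loc-⊞ : ∀ s (a : Fin m) b → toℕ a ≡ b → loc s (just (s ⊞ b)) ≡ place a
  loc-⊞ s a _ refl = cong place (trans (⊞-⊟ s (toℕ a)) (residue-toℕ a))

  loc-at : ∀ s q → loc s (at s q) ≡ q
  loc-at s (j , 0F) = trans (loc-⊞ s (j ↑ˡ n) (toℕ j) (toℕ-↑ˡ j n)) (place-↑ˡ j)
  loc-at s (j , 1F) with view j
  ... | ‵fromℕ     = refl
  ... | ‵inject₁ i = trans (loc-⊞ s (suc n ↑ʳ opposite i) _ (toℕ-↑ʳ (suc n) (opposite i)))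
                    (trans (place-↑ʳ (opposite i)) (cong (λ i → inject₁ i , 1F) (opposite-involutive i)))

  at-place : ∀ s (a : Fin m) → at s (place a) ≡ just (s ⊞ toℕ a)
  at-place s a with splitAt (suc n) a | join-splitAt (suc n) n a
  ... | inj₁ j | refl = cong (λ b → just (s ⊞ b)) (≡-sym (toℕ-↑ˡ j n))
  ... | inj₂ i | refl = trans (at-odd s (opposite i)) (cong (λ b → just (s ⊞ b))
      (trans (cong (λ i → suc n + toℕ i) (opposite-involutive i)) (≡-sym (toℕ-↑ʳ (suc n) i))))

  at-loc : ∀ s b → at s (loc s b) ≡ b
  at-loc s nothing  = at-last s
  at-loc s (just x) = trans (at-place s (x ⊟ s)) (cong just (trans (⊞-comm s (x ⊟ s)) (⊟-⊞ x s)))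

  Joins : Fin m → Position (suc n) → Vertex → Vertex → Set
  Joins s q b b′ = (at s q ≡ b × at s (succ q) ≡ b′) ⊎ (at s q ≡ b′ × at s (succ q) ≡ b)

  -- The cycle having {b , b′} at an even position: half of b + b′ + 1, as n + 1 = 1/2.
  parent : Vertex → Vertex → Fin m
  parent (just x) (just y) = residue (suc n * (toℕ x + toℕ y + 1))
  parent (just x) nothing  = x ⊞ suc n
  parent nothing  (just y) = y ⊞ suc n
  parent nothing  nothing  = zero

  parent-sym : ∀ b b′ → parent b b′ ≡ parent b′ b
  parent-sym (just x) (just y) = cong (λ a → residue (suc n * (a + 1))) (+-comm (toℕ x) (toℕ y))
  parent-sym (just x) nothing  = refl
  parent-sym nothing  (just y) = refl
  parent-sym nothing  nothing  = refl

  -- Modulo m the sum of the two vertices plus 1 is 2s, and multiplication by n + 1 halves it.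
  parent-⊞ : ∀ s a b → a + b + 1 ≡ m → parent (just (s ⊞ a)) (just (s ⊞ b)) ≡ s
  parent-⊞ s a b e = trans
    (residue-cong (*-≋ (suc n) (+-≋ {b = 1} (+-≋ (toℕ-residue-≋ (toℕ s + a)) (toℕ-residue-≋ (toℕ s + b))) ≋-refl)))
    (trans (residue-+* _ (toℕ s) (toℕ s + suc n) (begin
      suc n * (toℕ s + a + (toℕ s + b) + 1)     ≡⟨ cong (suc n *_) (regroup (toℕ s) a b) ⟩
      suc n * (2 * toℕ s + (a + b + 1))         ≡⟨ cong (λ t → suc n * (2 * toℕ s + t)) e ⟩
      suc n * (2 * toℕ s + m)                   ≡⟨ halve n (toℕ s) ⟩
      toℕ s + (toℕ s + suc n) * m               ∎))
    (residue-toℕ s))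
    where
    open ≡-Reasoning
    regroup : ∀ s a b → s + a + (s + b) + 1 ≡ 2 * s + (a + b + 1)
    regroup = solve-∀
    halve : ∀ n s → suc n * (2 * s + suc (n + n)) ≡ s + (s + suc n) * suc (n + n)
    halve = solve-∀

  toℕ-opposite : ∀ (i : Fin n) → toℕ (opposite i) + suc (toℕ i) ≡ n
  toℕ-opposite i = trans (cong (_+ suc (toℕ i)) (opposite-prop i)) (m∸n+n≡m (toℕ<n i))

  mirror-offset : ∀ (i : Fin n) → toℕ i + (suc n + toℕ (opposite i)) + 1 ≡ m
  mirror-offset i = trans (regroup (toℕ i) (toℕ (opposite i)) n) (cong (λ t → suc (n + t)) (toℕ-opposite i))
    where
    regroup : ∀ i o n → i + (suc n + o) + 1 ≡ suc (n + (o + suc i))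
    regroup = solve-∀

  n+sucn : n + suc n ≡ m
  n+sucn = +-comm n (suc n)

  parent-even : ∀ s j → parent (at s (j , 0F)) (at s (j , 1F)) ≡ s
  parent-even s j with view j
  ... | ‵fromℕ     = ⊞-⊞-period s (toℕ (fromℕ n)) (suc n) (trans (cong (_+ suc n) (toℕ-fromℕ n)) n+sucn)
  ... | ‵inject₁ i rewrite toℕ-inject₁ i = parent-⊞ s (toℕ i) (suc n + toℕ (opposite i)) (mirror-offset i)

  parent-unique : ∀ {s j b b′} → Joins s (j , 0F) b b′ → parent b b′ ≡ s
  parent-unique {s} {j} (inj₁ (refl , refl)) = parent-even s j
  parent-unique {s} {j} (inj₂ (refl , refl)) = trans (parent-sym (at s (j , 1F)) (at s (j , 0F))) (parent-even s j)

  -- Twice the parent is x + y + 1, and the last offset is -1 - x modulo m.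
  parent-inverse : ∀ x y → parent (just x) (just y) ⊞ toℕ (parent (just x) (just y)) ⊞ (n + n + (m ∸ toℕ x)) ≡ y
  parent-inverse x y = trans (cong (_⊞ r) (residue-cong (+-≋ (toℕ-residue-≋ p) (toℕ-residue-≋ p))))
    (trans (residue-cong (+-≋ {b = r} (toℕ-residue-≋ (p + p)) ≋-refl))
    (trans (residue-+* _ (toℕ y) (toℕ x + toℕ y + 3) (begin
      p + p + (n + n + (m ∸ toℕ x))                           ≡⟨ double n (toℕ x) (toℕ y) (m ∸ toℕ x) ⟩
      toℕ y + (toℕ x + toℕ y + 2) * m + (m ∸ toℕ x + toℕ x)   ≡⟨ cong (toℕ y + (toℕ x + toℕ y + 2) * m +_) (m∸toℕ x) ⟩
      toℕ y + (toℕ x + toℕ y + 2) * m + m                     ≡⟨ collect (toℕ y) (toℕ x + toℕ y) m ⟩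
      toℕ y + (toℕ x + toℕ y + 3) * m                         ∎))
    (residue-toℕ y)))
    where
    open ≡-Reasoning
    p = suc n * (toℕ x + toℕ y + 1)
    r = n + n + (m ∸ toℕ x)
    double : ∀ n x y z → suc n * (x + y + 1) + suc n * (x + y + 1) + (n + n + z) ≡ y + (x + y + 2) * suc (n + n) + (z + x)
    double = solve-∀
    collect : ∀ y t m → y + (t + 2) * m + m ≡ y + (t + 3) * m
    collect = solve-∀

  parent-injective : ∀ x {y z} → parent (just x) (just y) ≡ parent (just x) (just z) → y ≡ z
  parent-injective x {y} {z} e = trans (≡-sym (parent-inverse x y))
    (trans (cong (λ s → s ⊞ toℕ s ⊞ (n + n + (m ∸ toℕ x))) e) (parent-inverse x z))

  even-last : ∀ x → at (x ⊞ suc n) (fromℕ n , 0F) ≡ just x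
  even-last x = cong just (⊞-⊞-period x (suc n) (toℕ (fromℕ n)) (cong (suc n +_) (toℕ-fromℕ n)))

  -- Look at the partner of x along its even edge on the cycle `parent x y`. That edge has the same
  -- parent as {x , y}, so the partner is y by `parent-injective`.
  even-covers-just : ∀ x y → x ≢ y → ∀ q → at (parent (just x) (just y)) q ≡ just x →
                     Σ (Fin (suc n)) λ j → Joins (parent (just x) (just y)) (j , 0F) (just x) (just y)
  even-covers-just x y x≢y (j , 0F) e with view j
  -- Here the partner is ∞, so x = s + n. As n + n + 1 = m, the parent of x with itself is s as
  -- well, which would force y = x.
  ... | ‵fromℕ = ⊥-elim (x≢y (parent-injective x (begin
      parent (just x) (just x)             ≡⟨ cong₂ parent (≡-sym e) (≡-sym e) ⟩
      parent (at s (fromℕ n , 0F)) (at s (fromℕ n , 0F))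
                                           ≡⟨ parent-⊞ s (toℕ (fromℕ n)) (toℕ (fromℕ n)) middle ⟩
      s                                    ∎)))
    where
    open ≡-Reasoning
    s = parent (just x) (just y)
    middle : toℕ (fromℕ n) + toℕ (fromℕ n) + 1 ≡ m
    middle = trans (cong (λ t → t + t + 1) (toℕ-fromℕ n)) (+-comm (n + n) 1)
  ... | ‵inject₁ i = inject₁ i , inj₁ (e , trans (at-odd s i) (cong just (parent-injective x (begin
      parent (just x) (just _)  ≡⟨ cong₂ parent (≡-sym e) (≡-sym (at-odd s i)) ⟩
      parent (at s (inject₁ i , 0F)) (at s (inject₁ i , 1F))  ≡⟨ parent-even s (inject₁ i) ⟩
      s                         ∎))))
    where
    open ≡-Reasoning
    s = parent (just x) (just y)
  even-covers-just x y x≢y (j , 1F) e = j , inj₂ (cong just (parent-injective x (begin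
      parent (just x) (at s (j , 0F))  ≡⟨ cong (λ b → parent b (at s (j , 0F))) e ⟨
      parent (at s (j , 1F)) (at s (j , 0F))  ≡⟨ parent-sym (at s (j , 1F)) (at s (j , 0F)) ⟩
      parent (at s (j , 0F)) (at s (j , 1F))  ≡⟨ parent-even s j ⟩
      s                         ∎)) , e)
    where
    open ≡-Reasoning
    s = parent (just x) (just y)

  even-covers : ∀ {b b′} → b ≢ b′ → Σ (Fin (suc n)) λ j → Joins (parent b b′) (j , 0F) b b′
  even-covers {just x}  {just y}  b≢b′ = even-covers-just x y (λ e → b≢b′ (cong just e)) (loc s (just x)) (at-loc s (just x))
    where s = parent (just x) (just y)
  even-covers {just x}  {nothing} b≢b′ = fromℕ n , inj₁ (even-last x , at-last _)
  even-covers {nothing} {just y}  b≢b′ = fromℕ n , inj₂ (even-last y , at-last _)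
  even-covers {nothing} {nothing} b≢b′ = ⊥-elim (b≢b′ refl)

  at-injective : ∀ s {q q′} → at s q ≡ at s q′ → q ≡ q′
  at-injective s {q} {q′} e = trans (≡-sym (loc-at s q)) (trans (cong (loc s) e) (loc-at s q′))

  -- These add and subtract 1/2. The odd sums 2s of cycle s are the even sums 2(s + 1/2) - 1 of
  -- cycle `up s`.
  up down : Fin m → Fin m
  up s   = s ⊞ suc n
  down s = s ⊞ n

  up-down : ∀ s → up (down s) ≡ s
  up-down s = ⊞-⊞-period s n (suc n) n+sucn

  down-up : ∀ s → down (up s) ≡ s
  down-up s = ⊞-⊞-period s (suc n) n refl

  -- The odd edges of a cycle reappear as even edges of the next one in reverse order, each run
  -- through in the same direction. The exception is the edge at ∞, which stays last and is
  -- reversed.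
  reflect : {j : Fin (suc n)} → View j → Fin (suc n)
  reflect ‵fromℕ       = fromℕ n
  reflect (‵inject₁ i) = inject₁ (opposite i)

  mirror : Fin (suc n) → Fin (suc n)
  mirror j = reflect (view j)

  mirror-mirror : ∀ j → mirror (mirror j) ≡ j
  mirror-mirror j with view j
  ... | ‵fromℕ rewrite view-fromℕ n = refl
  ... | ‵inject₁ i rewrite view-inject₁ (opposite i) = cong inject₁ (opposite-involutive i)

  up-even : ∀ s i → at (up s) (inject₁ (opposite i) , 0F) ≡ at s (inject₁ i , 1F)
  up-even s i = trans (cong just (trans (cong (up s ⊞_) (toℕ-inject₁ (opposite i))) (⊞-⊞ s (suc n) (toℕ (opposite i)))))
                      (≡-sym (at-odd s i))

  up-odd : ∀ s i → at (up s) (inject₁ (opposite i) , 1F) ≡ at s (suc i , 0F)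
  up-odd s i = trans (at-odd (up s) (opposite i)) (cong just (begin
    s ⊞ suc n ⊞ (suc n + toℕ (opposite (opposite i)))   ≡⟨ cong (λ i → s ⊞ suc n ⊞ (suc n + toℕ i)) (opposite-involutive i) ⟩
    s ⊞ suc n ⊞ (suc n + toℕ i)                         ≡⟨ ⊞-⊞ s (suc n) (suc n + toℕ i) ⟩
    s ⊞ (suc n + (suc n + toℕ i))                       ≡⟨ cong (s ⊞_) (regroup n (toℕ i)) ⟩
    s ⊞ (suc (toℕ i) + m)                               ≡⟨ ⊞-period s (suc (toℕ i)) ⟩
    s ⊞ suc (toℕ i)                                     ∎))
    where
    open ≡-Reasoning
    regroup : ∀ n i → suc n + (suc n + i) ≡ suc i + suc (n + n)
    regroup = solve-∀

  up-last : ∀ s → at (up s) (fromℕ n , 0F) ≡ at s (zero , 0F)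
  up-last s = trans (even-last s) (cong just (≡-sym (⊞-zero s)))

-- Schemes from cyclically ordered Hamiltonian cycles.

⊖-swap : ∀ a b c d → a ⊖ b ≡ c ⊖ d → b ⊖ a ≡ d ⊖ c
⊖-swap = from-yes (all? λ a → all? λ b → all? λ c → all? λ d → (a ⊖ b ≟ c ⊖ d) →-dec (b ⊖ a ≟ d ⊖ c))

-- Every factor is a single Hamiltonian base cycle, and the odd edges of factor f
-- are the even edges of factor up f.
record HamiltonScheme {B : Set} (E : B → B → Set) (I : Set) (n : ℕ) : Set where
  field
    E-sym  : ∀ {b b′} → E b b′ → E b′ b
    at     : I → Position (suc n) → B
    loc    : I → B → Position (suc n)
    at-loc : ∀ f b → at f (loc f b) ≡ b
    loc-at : ∀ f q → loc f (at f q) ≡ q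
    hue    : I → Position (suc n) → Fin 3

  Joins : I → Position (suc n) → B → B → Set
  Joins f q b b′ = (at f q ≡ b × at f (succ q) ≡ b′) ⊎ (at f q ≡ b′ × at f (succ q) ≡ b)

  field
    even-edge     : ∀ f j → E (at f (j , 0F)) (at f (j , 1F))
    parent        : B → B → I
    even-covers   : ∀ {b b′} → E b b′ → Σ (Fin (suc n)) λ j → Joins (parent b b′) (j , 0F) b b′
    parent-unique : ∀ {f j b b′} → Joins f (j , 0F) b b′ → parent b b′ ≡ f
    up down       : I → I
    up-down       : ∀ f → up (down f) ≡ f
    down-up       : ∀ f → down (up f) ≡ f
    mirror        : Fin (suc n) → Fin (suc n)
    mirror-mirror : ∀ j → mirror (mirror j) ≡ j
    proper        : ∀ f q → hue f q ≢ hue f (succ q)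
    -- The alternatives are the two directions in which factor `up f` may run through the odd edge.
    -- Each one carries the comparison of potential differences.
    odd-even      : ∀ f j → let i = mirror j in
      (at (up f) (i , 0F) ≡ at f (j , 1F) × at (up f) (i , 1F) ≡ at f (next j , 0F) ×
       hue (up f) (i , 1F) ⊖ hue (up f) (i , 0F) ≢ hue f (next j , 0F) ⊖ hue f (j , 1F))
      ⊎
      (at (up f) (i , 1F) ≡ at f (j , 1F) × at (up f) (i , 0F) ≡ at f (next j , 0F) ×
       hue (up f) (i , 0F) ⊖ hue (up f) (i , 1F) ≢ hue f (next j , 0F) ⊖ hue f (j , 1F))

  col : I → B → Fin 3
  col f b = hue f (loc f b)

  col-at : ∀ f {q b} → at f q ≡ b → col f b ≡ hue f q
  col-at f {q} refl = cong (hue f) (loc-at f q)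

  odd⇒even : ∀ f j → Joins (up f) (mirror j , 0F) (at f (j , 1F)) (at f (next j , 0F))
  odd⇒even f j with odd-even f j
  ... | inj₁ (e , e′ , _) = inj₁ (e , e′)
  ... | inj₂ (e , e′ , _) = inj₂ (e′ , e)

  joins-odd⇒even : ∀ {f j b b′} → Joins f (j , 1F) b b′ → Joins (up f) (mirror j , 0F) b b′
  joins-odd⇒even {f} {j} (inj₁ (refl , refl)) = odd⇒even f j
  joins-odd⇒even {f} {j} (inj₂ (refl , refl)) = Sum.swap (odd⇒even f j)

  odd-edge : ∀ f j → E (at f (j , 1F)) (at f (next j , 0F))
  odd-edge f j with odd-even f j | even-edge (up f) (mirror j)
  ... | inj₁ (e , e′ , _) | A = subst₂ E e e′ A
  ... | inj₂ (e , e′ , _) | A = E-sym (subst₂ E e′ e A)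

  -- Moving on from `down f` and `mirror j` leads back to f and j, so the odd edge there is the
  -- given even edge.
  joins-even⇒odd : ∀ {f j b b′} → Joins f (j , 0F) b b′ → Joins (down f) (mirror j , 1F) b b′
  joins-even⇒odd {f} {j} J with odd⇒even (down f) (mirror j)
  ... | J′ rewrite up-down f | mirror-mirror j with J | J′
  ... | inj₁ (refl , refl) | inj₁ (e , e′) = inj₁ (≡-sym e , ≡-sym e′)
  ... | inj₁ (refl , refl) | inj₂ (e , e′) = inj₂ (≡-sym e′ , ≡-sym e)
  ... | inj₂ (refl , refl) | inj₁ (e , e′) = inj₂ (≡-sym e , ≡-sym e′)
  ... | inj₂ (refl , refl) | inj₂ (e , e′) = inj₁ (≡-sym e′ , ≡-sym e)

  opposed-up : ∀ f j → let b = at f (j , 1F) ; b′ = at f (next j , 0F) in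
                col (up f) b′ ⊖ col (up f) b ≢ col f b′ ⊖ col f b
  opposed-up f j rewrite loc-at f (j , 1F) | loc-at f (next j , 0F) with odd-even f j
  ... | inj₁ (e , e′ , d) rewrite col-at (up f) e | col-at (up f) e′ = d
  ... | inj₂ (e , e′ , d) rewrite col-at (up f) e | col-at (up f) e′ = d

  -- By uniqueness of the parent, f is `up f′`, so only neighbouring factors have to be compared.
  opposed-joins : ∀ {b b′ f f′ j j′} → Joins f (j , 0F) b b′ → Joins f′ (j′ , 1F) b b′ →
                   col f b′ ⊖ col f b ≢ col f′ b′ ⊖ col f′ b
  opposed-joins {b} {b′} {f′ = f′} {j′ = j′} J J′ with trans (≡-sym (parent-unique J)) (parent-unique (joins-odd⇒even J′)) | J′
  ... | refl | inj₁ (refl , refl) = opposed-up f′ j′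
  ... | refl | inj₂ (refl , refl) = λ e → opposed-up f′ j′ (⊖-swap (col (up f′) b′) (col (up f′) b) (col f′ b′) (col f′ b) e)

  scheme : Scheme E I ⊤ n
  scheme = record
    { at           = λ f _ → at f
    ; loc          = λ f b → tt , loc f b
    ; at-loc       = at-loc
    ; loc-at       = λ f _ q → cong (tt ,_) (loc-at f q)
    ; col          = col
    ; edge         = λ { f _ (j , 0F) → even-edge f j ; f _ (j , 1F) → odd-edge f j }
    ; joins-covers = λ { 0F {b} {b′} e → let (j , J) = even-covers e in parent b b′ , tt , j , J
                       ; 1F {b} {b′} e → let (j , J) = even-covers e in down (parent b b′) , tt , mirror j , joins-even⇒odd J }
    ; joins-unique = λ { 0F J J′ → trans (≡-sym (parent-unique J)) (parent-unique J′)
                       ; 1F {f = f} {f′} J J′ → trans (≡-sym (down-up f)) (trans (cong down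
                           (trans (≡-sym (parent-unique (joins-odd⇒even J))) (parent-unique (joins-odd⇒even J′)))) (down-up f′)) }
    ; proper       = λ f _ q e → proper f q (trans (≡-sym (col-at f refl)) (trans e (col-at f refl)))
    ; opposed      = opposed-joins
    }

-- Potentials on complete bipartite graphs.

-- This is -(a + b); the three elements of ℤ₃ sum to 0, so for a ≠ b it is the remaining colour.
third : Fin 3 → Fin 3 → Fin 3
third a b = (a ⊕ b) ⊕ (a ⊕ b)

third≢ˡ : ∀ a b → a ≢ b → a ≢ third a b
third≢ˡ = from-yes (all? λ a → all? λ b → ¬? (a ≟ b) →-dec ¬? (a ≟ third a b))

third≢ʳ : ∀ a b → a ≢ b → third a b ≢ b
third≢ʳ = from-yes (all? λ a → all? λ b → ¬? (a ≟ b) →-dec ¬? (third a b ≟ b))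

⊖-cancelʳ : ∀ a b c → a ⊖ c ≡ b ⊖ c → a ≡ b
⊖-cancelʳ = from-yes (all? λ a → all? λ b → all? λ c → (a ⊖ c ≟ b ⊖ c) →-dec (a ≟ b))

parity : ℕ → Fin 3
parity zero          = 0F
parity (suc zero)    = 1F
parity (suc (suc a)) = parity a

parity≢2 : ∀ a → parity a ≢ 2F
parity≢2 zero          ()
parity≢2 (suc zero)    ()
parity≢2 (suc (suc a)) = parity≢2 a

parity-suc : ∀ a → parity a ≢ parity (suc a)
parity-suc zero          ()
parity-suc (suc zero)    ()
parity-suc (suc (suc a)) = parity-suc a

-- Complete bipartite graphs K_{h,h}: factor c consists of the perfect matchings x ↦ x + c and x ↦ x + c + 1.
-- For a proper 3-colouring tint of the cycle ℤ/h, the edge {x , y} goes from third (tint x) (tint (x + 1))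
-- to tint x in one factor and to tint (x + 1) in the other, whence opposite differences.
module Bipartite (ν : ℕ) where
  n : ℕ
  n = suc ν
  open Residue n

  -- Alternate 0 and 1, and keep 2 for the last vertex, so that the cycle closes up whatever the
  -- parity of its length.
  tone : {j : Fin (suc n)} → View j → Fin 3
  tone ‵fromℕ       = 2F
  tone (‵inject₁ i) = parity (toℕ i)

  tint : Fin (suc n) → Fin 3
  tint j = tone (view j)

  tint-value : ∀ j → tint j ≡ 2F ⊎ tint j ≡ parity (toℕ j)
  tint-value j with view j
  ... | ‵fromℕ     = inj₁ refl
  ... | ‵inject₁ i = inj₂ (cong parity (≡-sym (toℕ-inject₁ i)))

  tint-next : ∀ j → tint j ≢ tint (next j)
  tint-next j with view j
  ... | ‵fromℕ rewrite next-fromℕ n = λ ()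
  ... | ‵inject₁ i rewrite next-inject₁ i with tint-value (suc i)
  ...   | inj₁ e = λ e′ → parity≢2 (toℕ i) (trans e′ e)
  ...   | inj₂ e = λ e′ → parity-suc (toℕ i) (trans e′ e)

  Vertex : Set
  Vertex = Fin 2 × Fin (suc n)

  at : Fin (suc n) → Position (suc n) → Vertex
  at c (j , 0F) = 1F , c ⊞ toℕ j
  at c (j , 1F) = 0F , j

  loc : Fin (suc n) → Vertex → Position (suc n)
  loc c (0F , x) = x , 1F
  loc c (1F , y) = y ⊟ c , 0F

  hue : Position (suc n) → Fin 3
  hue (j , 0F) = tint j
  hue (j , 1F) = third (tint j) (tint (next j))

  parent : Vertex → Vertex → Fin (suc n)
  parent (1F , y) (0F , x) = y ⊟ x
  parent (0F , x) (1F , y) = y ⊟ x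
  -- Default values, since no edge joins two vertices of one side.
  parent (0F , x) (0F , _) = x
  parent (1F , y) (1F , _) = y

  ⊞-⊟-toℕ : ∀ c j → c ⊞ toℕ j ⊟ j ≡ c
  ⊞-⊟-toℕ c j = trans (cong (_⊟ j) (⊞-comm c j)) (trans (⊞-⊟ j (toℕ c)) (residue-toℕ c))

  ⊞-next : ∀ c j → c ⊞ 1 ⊞ toℕ j ≡ c ⊞ toℕ (next j)
  ⊞-next c j = trans (⊞-⊞ c 1 (toℕ j)) (residue-cong (+-≋ {toℕ c} ≋-refl (congruent
    (trans (≡-sym (m%n%n≡m%n (suc (toℕ j)) (suc n))) (≡-sym (cong (_% m) (toℕ-next {n} j)))))))

  hamiltonScheme : HamiltonScheme {Vertex} (λ b b′ → proj₁ b ≢ proj₁ b′) (Fin (suc n)) n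
  hamiltonScheme = record
    { E-sym         = ≢-sym
    ; at            = at
    ; loc           = loc
    ; at-loc        = λ { c (0F , x) → refl
                        ; c (1F , y) → cong (1F ,_) (trans (⊞-comm c (y ⊟ c)) (⊟-⊞ y c)) }
    ; loc-at        = λ { c (j , 0F) → cong (_, 0F) (trans (⊞-⊟ c (toℕ j)) (residue-toℕ j))
                        ; c (j , 1F) → refl }
    ; hue           = λ _ → hue
    ; even-edge     = λ _ _ ()
    ; parent        = parent
    ; even-covers   = λ { {1F , y} {0F , x} _ → x , inj₁ (cong (1F ,_) (⊟-⊞ y x) , refl)
                        ; {0F , x} {1F , y} _ → x , inj₂ (cong (1F ,_) (⊟-⊞ y x) , refl)
                        ; {0F , _} {0F , _} e → ⊥-elim (e refl)
                        ; {1F , _} {1F , _} e → ⊥-elim (e refl) }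
    ; parent-unique = λ { {c} {j} (inj₁ (refl , refl)) → ⊞-⊟-toℕ c j
                        ; {c} {j} (inj₂ (refl , refl)) → ⊞-⊟-toℕ c j }
    ; up            = _⊞ 1
    ; down          = _⊞ n
    ; up-down       = λ c → ⊞-⊞-period c n 1 (+-comm n 1)
    ; down-up       = λ c → ⊞-⊞-period c 1 n refl
    ; mirror        = λ j → j
    ; mirror-mirror = λ _ → refl
    ; proper        = λ { c (j , 0F) → third≢ˡ _ _ (tint-next j)
                        ; c (j , 1F) → third≢ʳ (tint j) _ (tint-next j) }
    -- Factor c + 1 traverses the edge backwards. Its end on side 0 has the same potential in both
    -- factors, so the comparison reduces to `tint j` against `tint (next j)`.
    ; odd-even      = λ c j → inj₂ (refl , cong (1F ,_) (⊞-next c j)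
                        , λ e → tint-next j (⊖-cancelʳ (tint j) (tint (next j)) (hue (j , 1F)) e))
    }

-- Potentials on complete graphs.

opposite-inject₁ : ∀ {n} (i : Fin n) → opposite (inject₁ i) ≡ suc (opposite i)
opposite-inject₁ zero    = refl
opposite-inject₁ (suc i) = cong inject₁ (opposite-inject₁ i)

opposite-fromℕ : ∀ n → opposite (fromℕ n) ≡ zero
opposite-fromℕ zero    = refl
opposite-fromℕ (suc n) = cong inject₁ (opposite-fromℕ n)

module Complete (ν : ℕ) where
  -- The condition k > 6 enters here: for n ≥ 3 the index 1 lies below n - 1, so the successor of 0
  -- is always a middle index.
  n : ℕ
  n = 3 + ν
  open Walecki n

  -- The place of an index among 0 | 1 , … , n − 2 | n − 1 | n.
  Class : Set
  Class = Fin 4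

  pattern first  = 0F
  pattern middle = 1F
  pattern penult = 2F
  pattern final  = 3F

  beyond : {i : Fin (2 + ν)} → View i → Class
  beyond ‵fromℕ       = penult
  beyond (‵inject₁ _) = middle

  later : {i : Fin (3 + ν)} → View i → Class
  later ‵fromℕ       = final
  later (‵inject₁ i) = beyond (view i)

  class : Fin (suc n) → Class
  class zero    = first
  class (suc i) = later (view i)

  -- The classes of j , j + 1 and n − 1 − j, for j < n.
  steps : List (Class × Class × Class)
  steps = (first , middle , penult) ∷ (middle , middle , middle) ∷ (middle , penult , middle)
        ∷ (penult , final , first) ∷ []

  class-fromℕ : class (fromℕ n) ≡ final
  class-fromℕ rewrite view-fromℕ (2 + ν) = refl

  class-penult : class (suc (inject₁ (fromℕ (1 + ν)))) ≡ penult
  class-penult rewrite view-inject₁ (fromℕ (1 + ν)) | view-fromℕ (1 + ν) = refl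

  class-middle : ∀ i → class (suc (inject₁ (inject₁ i))) ≡ middle
  class-middle i rewrite view-inject₁ (inject₁ i) | view-inject₁ i = refl

  class-inject₁-suc : ∀ (i : Fin (2 + ν)) → class (suc (inject₁ i)) ≡ middle ⊎ class (suc (inject₁ i)) ≡ penult
  class-inject₁-suc i with view i
  ... | ‵fromℕ     = inj₂ class-penult
  ... | ‵inject₁ i = inj₁ (class-middle i)

  ∈-steps : ∀ {a b c x y z} → a ≡ x → b ≡ y → c ≡ z → (x , y , z) ∈ steps → (a , b , c) ∈ steps
  ∈-steps refl refl refl e = e

  class-mirrored : ∀ i → class (inject₁ (inject₁ (opposite (inject₁ i)))) ≡ middle
  class-mirrored i = trans (cong (λ i → class (inject₁ (inject₁ i))) (opposite-inject₁ i)) (class-middle (opposite i))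

  -- The reflection j ↦ n - 1 - j exchanges 0 and n - 1 and preserves the range of middle indices.
  step : ∀ i → (class (inject₁ i) , class (suc i) , class (inject₁ (opposite i))) ∈ steps
  step zero    = ∈-steps refl refl class-penult (here refl)
  step (suc i) = go (view i)
    where
    go : ∀ {i} → View i → (class (inject₁ (suc i)) , class (suc (suc i)) , class (inject₁ (opposite (suc i)))) ∈ steps
    go ‵fromℕ = ∈-steps class-penult class-fromℕ (cong (λ i → class (inject₁ (inject₁ i))) (opposite-fromℕ (1 + ν)))
      (there (there (there (here refl))))
    go (‵inject₁ i) with class-inject₁-suc (suc i)
    ... | inj₁ e = ∈-steps (class-middle i) e (class-mirrored i) (there (here refl))
    ... | inj₂ e = ∈-steps (class-middle i) e (class-mirrored i) (there (there (here refl)))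

  -- The factors 0 , n + 1 and 1, which are consecutive under up, break the pattern;
  -- the others are low if below n + 1 and high if above.
  Kind : Set
  Kind = Fin 5

  pattern zeroth = 0F
  pattern half   = 1F
  pattern one    = 2F
  pattern low    = 3F
  pattern high   = 4F

  kind⊎ : Fin (suc n) ⊎ Fin n → Kind
  kind⊎ (inj₁ zero)          = zeroth
  kind⊎ (inj₁ (suc zero))    = one
  kind⊎ (inj₁ (suc (suc _))) = low
  kind⊎ (inj₂ zero)          = half
  kind⊎ (inj₂ (suc _))       = high

  kind : Fin m → Kind
  kind s = kind⊎ (splitAt (suc n) s)

  -- Under `up` the factors run through 0, n + 1, 1, n + 2, 2, ..., 2n, n and back to 0, so high and
  -- low alternate after the three exceptional ones.
  ups : List (Kind × Kind)
  ups = (zeroth , half) ∷ (half , one) ∷ (one , high) ∷ (high , low) ∷ (low , high) ∷ (low , zeroth) ∷ []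

  up-inject₁ : ∀ i → up (inject₁ i ↑ˡ n) ≡ suc n ↑ʳ i
  up-inject₁ i = trans (cong residue (begin
    toℕ (inject₁ i ↑ˡ n) + suc n   ≡⟨ cong (_+ suc n) (trans (toℕ-↑ˡ (inject₁ i) n) (toℕ-inject₁ i)) ⟩
    toℕ i + suc n                  ≡⟨ +-comm (toℕ i) (suc n) ⟩
    suc n + toℕ i                  ≡⟨ toℕ-↑ʳ (suc n) i ⟨
    toℕ (suc n ↑ʳ i)               ∎)) (residue-toℕ (suc n ↑ʳ i))
    where open ≡-Reasoning

  up-fromℕ : up (fromℕ n ↑ˡ n) ≡ zero
  up-fromℕ = trans (residue-+* (toℕ (fromℕ n ↑ˡ n) + suc n) 0 1 (begin
    toℕ (fromℕ n ↑ˡ n) + suc n   ≡⟨ cong (_+ suc n) (trans (toℕ-↑ˡ (fromℕ n) n) (toℕ-fromℕ n)) ⟩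
    n + suc n                    ≡⟨ n+sucn ⟩
    m                            ≡⟨ +-identityʳ m ⟨
    1 * m                        ∎)) (residue-toℕ zero)
    where open ≡-Reasoning

  up-↑ʳ : ∀ i → up (suc n ↑ʳ i) ≡ suc i ↑ˡ n
  up-↑ʳ i = trans (residue-+* (toℕ (suc n ↑ʳ i) + suc n) (toℕ (suc i ↑ˡ n)) 1 (begin
    toℕ (suc n ↑ʳ i) + suc n       ≡⟨ cong (_+ suc n) (toℕ-↑ʳ (suc n) i) ⟩
    suc n + toℕ i + suc n          ≡⟨ regroup n (toℕ i) ⟩
    suc (toℕ i) + 1 * m            ≡⟨ cong (_+ 1 * m) (toℕ-↑ˡ (suc i) n) ⟨
    toℕ (suc i ↑ˡ n) + 1 * m       ∎)) (residue-toℕ (suc i ↑ˡ n))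
    where
    open ≡-Reasoning
    regroup : ∀ n i → suc n + i + suc n ≡ suc i + 1 * suc (n + n)
    regroup = solve-∀

  kind-↑ˡ : ∀ j → kind (j ↑ˡ n) ≡ kind⊎ (inj₁ j)
  kind-↑ˡ j = cong kind⊎ (splitAt-↑ˡ (suc n) j n)

  kind-↑ʳ : ∀ i → kind (suc n ↑ʳ i) ≡ kind⊎ (inj₂ i)
  kind-↑ʳ i = cong kind⊎ (splitAt-↑ʳ (suc n) n i)

  kind-up : ∀ s → (kind s , kind (up s)) ∈ ups
  kind-up s = subst (λ s → (kind s , kind (up s)) ∈ ups) (join-splitAt (suc n) n s) (joined (splitAt (suc n) s))
    where
    kinds : ∀ s {t x y} → kind s ≡ x → up s ≡ t → kind t ≡ y → (x , y) ∈ ups → (kind s , kind (up s)) ∈ ups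
    kinds s refl refl refl e = e
    joined : ∀ j → (kind (join (suc n) n j) , kind (up (join (suc n) n j))) ∈ ups
    joined (inj₁ j) with view j
    ... | ‵fromℕ =
      kinds (fromℕ n ↑ˡ n) (kind-↑ˡ (fromℕ n)) up-fromℕ refl (there (there (there (there (there (here refl))))))
    ... | ‵inject₁ zero =
      kinds zero (kind-↑ˡ zero) (up-inject₁ zero) (kind-↑ʳ zero) (here refl)
    ... | ‵inject₁ (suc zero) =
      kinds (suc zero) (kind-↑ˡ (suc zero)) (up-inject₁ (suc zero)) (kind-↑ʳ (suc zero)) (there (there (here refl)))
    ... | ‵inject₁ i@(suc (suc _)) =
      kinds (inject₁ i ↑ˡ n) (kind-↑ˡ (inject₁ i)) (up-inject₁ i) (kind-↑ʳ i) (there (there (there (there (here refl)))))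
    joined (inj₂ zero) =
      kinds (suc n ↑ʳ zero) (kind-↑ʳ zero) (up-↑ʳ zero) (kind-↑ˡ (suc zero)) (there (here refl))
    joined (inj₂ i@(suc _)) =
      kinds (suc n ↑ʳ i) (kind-↑ʳ i) (up-↑ʳ i) (kind-↑ˡ (suc i)) (there (there (there (here refl))))

  -- Rows are kinds and columns are classes. In the low and high factors the potential is a 2-colouring,
  -- up to the colour of ∞, which has to alternate along up; as the number 2n + 1 of factors is odd,
  -- the alternation must be broken somewhere, and this is what the first three rows do.
  palette : Fin 2 → Vec (Vec (Fin 3) 4) 5
  palette 0F = (0F ∷ 1F ∷ 1F ∷ 2F ∷ [])
             ∷ (0F ∷ 2F ∷ 2F ∷ 2F ∷ [])
             ∷ (0F ∷ 2F ∷ 2F ∷ 2F ∷ [])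
             ∷ (0F ∷ 0F ∷ 0F ∷ 0F ∷ [])
             ∷ (0F ∷ 0F ∷ 0F ∷ 0F ∷ [])
             ∷ []
  palette 1F = (2F ∷ 0F ∷ 0F ∷ 1F ∷ [])
             ∷ (1F ∷ 1F ∷ 0F ∷ 1F ∷ [])
             ∷ (1F ∷ 1F ∷ 1F ∷ 1F ∷ [])
             ∷ (2F ∷ 2F ∷ 2F ∷ 1F ∷ [])
             ∷ (2F ∷ 2F ∷ 2F ∷ 2F ∷ [])
             ∷ []

  paint : Kind → Class → Fin 2 → Fin 3
  paint κ x ε = lookup (lookup (palette ε) κ) x

  hue : Fin m → Position (suc n) → Fin 3
  hue s (j , ε) = paint (kind s) (class j) ε

  paint-even : ∀ κ x → paint κ x 0F ≢ paint κ x 1F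
  paint-even = from-yes (all? λ κ → all? λ x → ¬? (paint κ x 0F ≟ paint κ x 1F))

  paint-odd : ∀ κ → All (λ (x , y , _) → paint κ x 1F ≢ paint κ y 0F) steps
  paint-odd = from-yes (all? λ κ → All.all? (λ (x , y , _) → ¬? (paint κ x 1F ≟ paint κ y 0F)) steps)

  paint-last : ∀ κ → paint κ final 1F ≢ paint κ first 0F
  paint-last = from-yes (all? λ κ → ¬? (paint κ final 1F ≟ paint κ first 0F))

  -- Colours depend only on kind and class, so a finite check over `ups` and `steps` settles all n
  -- at once.
  paint-up : All (λ (κ , κ′) → All (λ (x , y , z) → paint κ′ z 1F ⊖ paint κ′ z 0F ≢ paint κ y 0F ⊖ paint κ x 1F) steps) ups
  paint-up = from-yes (All.all? (λ (κ , κ′) → All.all? (λ (x , y , z) →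
    ¬? (paint κ′ z 1F ⊖ paint κ′ z 0F ≟ paint κ y 0F ⊖ paint κ x 1F)) steps) ups)

  -- The edge at ∞ is reversed from one factor to the next. With even positions coloured 0 in both,
  -- keeping the colour of ∞ would therefore repeat the difference; hence the alternation.
  paint-up-last : All (λ (κ , κ′) → paint κ′ final 0F ⊖ paint κ′ final 1F ≢ paint κ first 0F ⊖ paint κ final 1F) ups
  paint-up-last = from-yes (All.all? (λ (κ , κ′) →
    ¬? (paint κ′ final 0F ⊖ paint κ′ final 1F ≟ paint κ first 0F ⊖ paint κ final 1F)) ups)

  proper : ∀ s q → hue s q ≢ hue s (succ q)
  proper s (j , 0F) = paint-even (kind s) (class j)
  proper s (j , 1F) with view j
  ... | ‵fromℕ rewrite next-fromℕ n | class-fromℕ = paint-last (kind s)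
  ... | ‵inject₁ i rewrite next-inject₁ i = All.lookup (paint-odd (kind s)) (step i)

  odd-even : ∀ s j → let i = mirror j in
      (at (up s) (i , 0F) ≡ at s (j , 1F) × at (up s) (i , 1F) ≡ at s (next j , 0F) ×
       hue (up s) (i , 1F) ⊖ hue (up s) (i , 0F) ≢ hue s (next j , 0F) ⊖ hue s (j , 1F))
      ⊎
      (at (up s) (i , 1F) ≡ at s (j , 1F) × at (up s) (i , 0F) ≡ at s (next j , 0F) ×
       hue (up s) (i , 0F) ⊖ hue (up s) (i , 1F) ≢ hue s (next j , 0F) ⊖ hue s (j , 1F))
  odd-even s j with view j
  ... | ‵fromℕ rewrite next-fromℕ n | class-fromℕ =
    inj₂ (at-last (up s) , up-last s , All.lookup paint-up-last (kind-up s))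
  ... | ‵inject₁ i rewrite next-inject₁ i =
    inj₁ (trans (up-even s i) (at-odd s i) , up-odd s i , All.lookup (All.lookup paint-up (kind-up s)) (step i))

  hamiltonScheme : HamiltonScheme {Vertex} _≢_ (Fin m) n
  hamiltonScheme = record
    { E-sym         = ≢-sym
    ; at            = at
    ; loc           = loc
    ; at-loc        = at-loc
    ; loc-at        = loc-at
    ; hue           = hue
    ; even-edge     = λ s j e → even≢odd (at-injective s e)
    ; parent        = parent
    ; even-covers   = even-covers
    ; parent-unique = parent-unique
    ; up            = up
    ; down          = down
    ; up-down       = up-down
    ; down-up       = down-up
    ; mirror        = mirror
    ; mirror-mirror = mirror-mirror
    ; proper        = proper
    ; odd-even      = odd-even
    }
    where
    even≢odd : ∀ {j} → _≢_ {A = Position (suc n)} (j , 0F) (j , 1F)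
    even≢odd ()

-- Unions of schemes over partitions into blocks.

module Union {B D P : Set} {E : B → B → Set} {B′ I : D → Set} {E′ : ∀ d → B′ d → B′ d → Set} {n : ℕ}
  (S : ∀ d → Scheme (E′ d) (I d) ⊤ n) (split : ∀ d → B ↔ (P × B′ d)) where

  private
    module S d = Scheme (S d)
    module split d = Inverse (split d)

  part : ∀ d → B → P
  part d b = proj₁ (split.to d b)

  rest : ∀ d → B → B′ d
  rest d b = proj₂ (split.to d b)

  Within : D → B → B → Set
  Within d b b′ = part d b ≡ part d b′ × E′ d (rest d b) (rest d b′)

  -- A factor uses the same Hamiltonian cycle in every block of the partition d at once, so its
  -- cycles are indexed by the blocks.
  at : Σ D I → P → Position (suc n) → B
  at (d , f) p q = split.from d (p , S.at d f tt q)

  to-at : ∀ d f p q → split.to d (at (d , f) p q) ≡ (p , S.at d f tt q)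
  to-at d f p q = split.strictlyInverseˡ d (p , S.at d f tt q)

  Joins : Σ D I → P → Position (suc n) → B → B → Set
  Joins f p q b b′ = (at f p q ≡ b × at f p (succ q) ≡ b′) ⊎ (at f p q ≡ b′ × at f p (succ q) ≡ b)

  at-within : ∀ d f p q → Within d (at (d , f) p q) (at (d , f) p (succ q))
  at-within d f p q rewrite to-at d f p q | to-at d f p (succ q) = refl , S.edge d f tt q

  joins-rest : ∀ {d f p q b b′} → Joins (d , f) p q b b′ → S.Joins d f tt q (rest d b) (rest d b′)
  joins-rest {d} {f} {p} {q} (inj₁ (refl , refl)) rewrite to-at d f p q | to-at d f p (succ q) = inj₁ (refl , refl)
  joins-rest {d} {f} {p} {q} (inj₂ (refl , refl)) rewrite to-at d f p q | to-at d f p (succ q) = inj₂ (refl , refl)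

  rest-at : ∀ d {f p q b} → p ≡ part d b → S.at d f tt q ≡ rest d b → at (d , f) p q ≡ b
  rest-at d {b = b} refl e = trans (cong (λ x → split.from d (part d b , x)) e) (split.strictlyInverseʳ d b)

  rest-joins : ∀ {d f q b b′} → part d b ≡ part d b′ → S.Joins d f tt q (rest d b) (rest d b′) →
               Joins (d , f) (part d b) q b b′
  rest-joins {d} p (inj₁ (e , e′)) = inj₁ (rest-at d refl e , rest-at d p e′)
  rest-joins {d} p (inj₂ (e , e′)) = inj₂ (rest-at d p e , rest-at d refl e′)

  col : Σ D I → B → Fin 3
  col (d , f) b = S.col d f (rest d b)

  -- The hypotheses make E the disjoint union of the symmetric relations `Within d`. Two cycles
  -- sharing an edge then belong to the same d, where the block scheme decides.
  module _ (E⇒within : ∀ {b b′} → E b b′ → Σ D λ d → Within d b b′)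
           (within⇒E : ∀ {d b b′} → Within d b b′ → E b b′)
           (within-sym : ∀ {d b b′} → Within d b b′ → Within d b′ b)
           (within-unique : ∀ {d d′ b b′} → Within d b b′ → Within d′ b b′ → d ≡ d′) where

    joins-within : ∀ {d f p q b b′} → Joins (d , f) p q b b′ → Within d b b′
    joins-within {d} {f} {p} {q} (inj₁ (refl , refl)) = at-within d f p q
    joins-within {d} {f} {p} {q} (inj₂ (refl , refl)) = within-sym (at-within d f p q)

    joins-unique : ∀ ε {b b′ f f′ p p′ j j′} → Joins f p (j , ε) b b′ → Joins f′ p′ (j′ , ε) b b′ → f ≡ f′
    joins-unique ε {f = d , f} {d′ , f′} J J′ with within-unique (joins-within J) (joins-within J′)
    ... | refl = cong (d ,_) (S.joins-unique d ε (joins-rest J) (joins-rest J′))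

    opposed : ∀ {b b′ f f′ p p′ j j′} → Joins f p (j , 0F) b b′ → Joins f′ p′ (j′ , 1F) b b′ →
               col f b′ ⊖ col f b ≢ col f′ b′ ⊖ col f′ b
    opposed {f = d , f} {d′ , f′} J J′ with within-unique (joins-within J) (joins-within J′)
    ... | refl = S.opposed d (joins-rest J) (joins-rest J′)

    scheme : Scheme E (Σ D I) P n
    scheme = record
      { at           = at
      ; loc          = λ (d , f) b → part d b , proj₂ (S.loc d f (rest d b))
      ; at-loc       = λ (d , f) b → rest-at d refl (S.at-loc d f (rest d b))
      ; loc-at       = λ (d , f) p q → cong₂ _,_ (cong proj₁ (to-at d f p q))
                         (trans (cong (λ x → proj₂ (S.loc d f (proj₂ x))) (to-at d f p q)) (cong proj₂ (S.loc-at d f tt q)))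
      ; col          = col
      ; edge         = λ (d , f) p q → within⇒E (at-within d f p q)
      ; joins-covers = λ ε {b} e → let (d , p , e′)    = E⇒within e
                                       (f , _ , j , J) = S.joins-covers d ε e′
                                   in (d , f) , part d b , j , rest-joins p J
      ; joins-unique = joins-unique
      ; proper       = λ (d , f) p q → S.proper-joins d (joins-rest {d} {f} {p} {q} (inj₁ (refl , refl)))
      ; opposed      = opposed
      }

-- Assembly of the factorization.

-- The 2y groups of size h = 4 + ν are the vertices of K₂ᵧ, and each 1-factor d of K₂ᵧ
-- (the even edges of a Walecki cycle) splits into y pairs of groups. The pairs of 1-factor zero
-- carry complete graphs, those of the other ones complete bipartite graphs.
module Assembly (ν z : ℕ) {N : ℕ} (coordinates : Fin N ↔ (Walecki.Vertex z × Fin (4 + ν))) where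
  module W = Walecki z
  module C = Complete ν
  module CW = Walecki (3 + ν)
  module Bi = Bipartite (2 + ν)

  h y : ℕ
  h = 4 + ν
  y = suc z

  -- The positions (j , 0) and (j , 1) are the ends of even edge j, so this is adjacency in the
  -- 1-factor of even edges of cycle s.
  Matched : Fin W.m → W.Vertex → W.Vertex → Set
  Matched s v v′ = proj₁ (W.loc s v) ≡ proj₁ (W.loc s v′) × proj₂ (W.loc s v) ≢ proj₂ (W.loc s v′)

  parent-matched : ∀ {v v′} → v ≢ v′ → Matched (W.parent v v′) v v′
  parent-matched {v} {v′} v≢v′ = joined (proj₂ (W.even-covers v≢v′))
    where
    joined : ∀ {s j v v′} → W.Joins s (j , 0F) v v′ → Matched s v v′
    joined {s} {j} (inj₁ (refl , refl)) rewrite W.loc-at s (j , 0F) | W.loc-at s (j , 1F) = refl , λ ()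
    joined {s} {j} (inj₂ (refl , refl)) rewrite W.loc-at s (j , 0F) | W.loc-at s (j , 1F) = refl , λ ()

  -- Together with `parent-matched` this makes the 1-factors a 1-factorization of K₂ᵧ, in which the
  -- 1-factor of an edge is its parent.
  matched-parent : ∀ {s v v′} → Matched s v v′ → W.parent v v′ ≡ s
  matched-parent {s} {v} {v′} M with W.loc s v | W.loc s v′ | W.at-loc s v | W.at-loc s v′ | M
  ... | j , 0F | _ , 0F | e | e′ | refl , ε≢ε = ⊥-elim (ε≢ε refl)
  ... | j , 1F | _ , 1F | e | e′ | refl , ε≢ε = ⊥-elim (ε≢ε refl)
  ... | j , 0F | _ , 1F | e | e′ | refl , _   = W.parent-unique (inj₁ (e , e′))
  ... | j , 1F | _ , 0F | e | e′ | refl , _   = W.parent-unique (inj₂ (e′ , e))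

  vertex↔ : Fin W.m → W.Vertex ↔ (Fin y × Fin 2)
  vertex↔ s = mk↔ₛ′ (W.loc s) (W.at s) (W.loc-at s) (W.at-loc s)

  -- Cycle zero serves as a numbering of the 2h vertices of a complete block.
  pair↔ : (Fin 2 × Fin h) ↔ CW.Vertex
  pair↔ = mk↔ₛ′ (λ (ε , x) → CW.at zero (x , ε)) (λ b → let (x , ε) = CW.loc zero b in ε , x)
    (CW.at-loc zero) (λ (ε , x) → cong (λ (x , ε) → ε , x) (CW.loc-at zero (x , ε)))

  module coordinates = Inverse coordinates

  Block Index : Fin W.m → Set
  Block zero    = CW.Vertex
  Block (suc _) = Fin 2 × Fin h
  Index zero    = Fin CW.m
  Index (suc _) = Fin h

  BlockEdge : ∀ d → Block d → Block d → Set
  BlockEdge zero    b b′ = b ≢ b′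
  BlockEdge (suc _) b b′ = proj₁ b ≢ proj₁ b′

  blockScheme : ∀ d → Scheme (BlockEdge d) (Index d) ⊤ (3 + ν)
  blockScheme zero    = HamiltonScheme.scheme C.hamiltonScheme
  blockScheme (suc _) = HamiltonScheme.scheme Bi.hamiltonScheme

  block↔ : ∀ d → (Fin 2 × Fin h) ↔ Block d
  block↔ zero    = pair↔
  block↔ (suc _) = ↔-refl

  split : ∀ d → Fin N ↔ (Fin y × Block d)
  split d = ↔-trans coordinates (↔-trans (vertex↔ d ×-↔ ↔-refl) (↔-trans
    (mk↔ₛ′ (λ ((p , ε) , x) → p , (ε , x)) (λ (p , (ε , x)) → (p , ε) , x) (λ _ → refl) (λ _ → refl))
    (↔-refl ×-↔ block↔ d)))

  open Union {E = _≢_} blockScheme split using (Within; scheme)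

  pair-injective : ∀ c c′ → Inverse.to pair↔ c ≡ Inverse.to pair↔ c′ → c ≡ c′
  pair-injective (ε , x) (ε′ , x′) e = cong (λ (x , ε) → ε , x) (CW.at-injective zero {x , ε} {x′ , ε′} e)

  group : Fin N → W.Vertex
  group b = proj₁ (coordinates.to b)

  cell : ∀ d → Fin N → Fin 2 × Fin h
  cell d b = proj₂ (W.loc d (group b)) , proj₂ (coordinates.to b)

  within-irrefl : ∀ d {b} → Within d b b → ⊥
  within-irrefl zero    (_ , ne) = ne refl
  within-irrefl (suc _) (_ , ne) = ne refl

  within-sym : ∀ {d b b′} → Within d b b′ → Within d b′ b
  within-sym {zero}  (e , ne) = ≡-sym e , ≢-sym ne
  within-sym {suc _} (e , ne) = ≡-sym e , ≢-sym ne

  matched-within : ∀ d {b b′} → Matched d (group b) (group b′) → Within d b b′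
  matched-within zero {b} {b′} (e , ne) = e , λ e′ → ne (cong proj₁ (pair-injective (cell zero b) (cell zero b′) e′))
  matched-within (suc d) M = M

  within-matched : ∀ d {b b′} → group b ≢ group b′ → Within d b b′ → Matched d (group b) (group b′)
  within-matched zero {b} {b′} v≢v′ (e , _) = e , λ e′ →
    v≢v′ (trans (≡-sym (W.at-loc zero (group b))) (trans (cong (W.at zero) (cong₂ _,_ e e′)) (W.at-loc zero (group b′))))
  within-matched (suc d) v≢v′ M = M

  -- Vertices of one group lie on the same side in every 1-factor, and a bipartite block has no
  -- edges inside a side.
  within-group : ∀ d {b b′} → group b ≡ group b′ → Within d b b′ → d ≡ zero
  within-group zero    e M        = refl
  within-group (suc d) e (_ , ne) = ⊥-elim (ne (cong (λ v → proj₂ (W.loc (suc d) v)) e))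

  group-cases : ∀ b b′ {A : Set} → (group b ≡ group b′ → A) → (group b ≢ group b′ → A) → A
  group-cases b b′ same different with ≡-dec _≟_ (group b) (group b′)
  ... | yes e = same e
  ... | no ne = different ne

  coordinates-injective : ∀ {b b′} → coordinates.to b ≡ coordinates.to b′ → b ≡ b′
  coordinates-injective {b} {b′} e = trans (≡-sym (coordinates.strictlyInverseʳ b))
    (trans (cong coordinates.from e) (coordinates.strictlyInverseʳ b′))

  -- Edges inside a group go to the complete blocks of 1-factor zero; an edge between two groups
  -- goes to the 1-factor that matches them.
  ≢⇒within : ∀ {b b′} → b ≢ b′ → Σ (Fin W.m) λ d → Within d b b′
  ≢⇒within {b} {b′} b≢b′ = group-cases b b′
    (λ v≡v′ → zero , cong (λ v → proj₁ (W.loc zero v)) v≡v′ , λ e →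
      b≢b′ (coordinates-injective (cong₂ _,_ v≡v′ (cong proj₂ (pair-injective (cell zero b) (cell zero b′) e)))))
    (λ v≢v′ → W.parent (group b) (group b′) , matched-within _ {b} {b′} (parent-matched v≢v′))

  within-unique : ∀ {d d′ b b′} → Within d b b′ → Within d′ b b′ → d ≡ d′
  within-unique {d} {d′} {b} {b′} M M′ = group-cases b b′
    (λ e → trans (within-group d {b} {b′} e M) (≡-sym (within-group d′ {b} {b′} e M′)))
    (λ ne → trans (≡-sym (matched-parent {d} {group b} {group b′} (within-matched d {b} {b′} ne M)))
                  (matched-parent {d′} {group b} {group b′} (within-matched d′ {b} {b′} ne M′)))

  -- The complete blocks contribute k - 1 factors, and each of the other 2y - 2 1-factors
  -- contributes h.
  index↔ : Fin (CW.m + (z + z) * h) ↔ Σ (Fin W.m) Index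
  index↔ = ↔-trans +↔⊎ (↔-trans (↔-refl ⊎-↔ *↔× {z + z} {h}) (mk↔ₛ′
    (λ { (inj₁ f) → zero , f ; (inj₂ (d , f)) → suc d , f })
    (λ { (zero , f) → inj₁ f ; (suc d , f) → inj₂ (d , f) })
    (λ { (zero , f) → refl ; (suc d , f) → refl })
    (λ { (inj₁ f) → refl ; (inj₂ (d , f)) → refl })))

  factorization : Factorization (K 3 ⊗ K N) (suc ((3 + ν) * 2))
  factorization = Lift.factorization
    (scheme ≢⇒within (λ { {d} M refl → within-irrefl d M }) within-sym within-unique) index↔ ↔-refl

coordinates : ∀ h z → Fin (h * 2 * suc z) ↔ (Walecki.Vertex z × Fin h)
coordinates h z = ↔-trans *↔× (↔-trans (*↔× {h} {2} ×-↔ ↔-refl) (mk↔ₛ′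
    -- Cycle zero on the groups serves as a numbering of them by pair p and side ε.
    (λ ((x , ε) , p) → at zero (p , ε) , x)
    (λ (v , x) → let (p , ε) = loc zero v in (x , ε) , p)
    (λ (v , x) → cong (_, x) (at-loc zero v))
    (λ ((x , ε) , p) → cong (λ (p , ε) → (x , ε) , p) (loc-at zero (p , ε)))))
  where open Walecki z

theorem3p6 : (k y : ℕ) → 2 ∣ k → 6 < k → 2 ≤ y →
    HasCkFactorization (K 3 ⊗ K (k * y)) k
-- The quotient q is h; as 6 < 2q it is at least 4, and the remaining clauses refute the smaller
-- quotients.
theorem3p6 .(q * 2) (suc z) (divides q@(suc (suc (suc (suc ν)))) refl) 6<k 2≤y = Assembly.factorization ν z (coordinates q z)
theorem3p6 _ y (divides 0 refl) ()
theorem3p6 _ y (divides 1 refl) (s≤s (s≤s ()))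
theorem3p6 _ y (divides 2 refl) (s≤s (s≤s (s≤s (s≤s ()))))
theorem3p6 _ y (divides 3 refl) (s≤s (s≤s (s≤s (s≤s (s≤s (s≤s ()))))))
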